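{- For every $\epsilon>0$ there is $n_0$ such that for every $n>n_0$, $irr(n)\ge n^{2-\epsilon}$.
   Context: A hypergraph $H=(V,E)$ has a finite vertex set $V$ and a set $E$ of subsets of $V$ (hyperedges). An edge-labeling $g:E\to\{1,2,\dots\}$ is irregular if the sums $\sigma(x)=\sum_{e\in E,\, e\ni x}g(e)$, $x\in V$, are pairwise distinct. $irr(H)$ is the smallest possible value of the largest label in an irregular labeling of $H$, and $irr(n)$ is the largest value of $irr(H)$ over all $n$-vertex hypergraphs $H$ (admitting an irregular labeling). -}

module Defs where

open import Data.Nat using (ℕ; zero; suc; _+_; _≤_)
open import Data.Fin using (Fin)
open import Data.Fin.Subset using (Subset)
open import Data.Vec using (lookup)
open import Data.Bool using (if_then_else_)
open import Data.Product using (Σ; ∃; _×_)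
open import Relation.Binary.PropositionalEquality using (_≡_)
open import Function.Definitions using (Injective)

Σ< : (m : ℕ) → (Fin m → ℕ) → ℕ
Σ< zero    f = 0
Σ< (suc m) f = f Fin.zero + Σ< m (λ i → f (Fin.suc i))

record Hypergraph (n : ℕ) : Set where
  field
    m        : ℕ
    edge     : Fin m → Subset n
    edge-inj : Injective _≡_ _≡_ edge
open Hypergraph public

record Labeling {n : ℕ} (H : Hypergraph n) : Set where
  field
    g   : Fin (m H) → ℕ
    pos : ∀ e → 1 ≤ g e
open Labeling public

σ : ∀ {n} {H : Hypergraph n} → Labeling H → Fin n → ℕ
σ {H = H} L x = Σ< (m H) (λ e → if lookup (edge H e) x then g L e else 0)

Irregular : ∀ {n} {H : Hypergraph n} → Labeling H → Set
Irregular L = ∀ x y → σ L x ≡ σ L y → x ≡ y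

irrH≥ : ∀ {n} → Hypergraph n → ℕ → Set
irrH≥ H k = ∀ (L : Labeling H) → Irregular L → ∃ λ e → k ≤ g L e

-- irr(n) ≥ k : some n-vertex hypergraph admitting an irregular labeling
-- has irr(H) ≥ k (irr(n) is the maximum of irr(H) over such H).
irr≥ : ℕ → ℕ → Set
irr≥ n k = Σ (Hypergraph n) λ H → (Σ (Labeling H) Irregular) × irrH≥ H k

{-# OPTIONS --safe #-}

-- The vertices are n distinct vectors in {0,1}^m with m of order log n, the edges are the
-- m coordinates, and a labeling g : [m] → [0,k) gives the vertex v the sum ⟨g,v⟩ < k m.
-- By the birthday paradox n random vectors have a repeated sum for a given g, except with
-- probability about exp(− n² / k m), so as long as k ≤ n² / polylog n some choice of
-- vectors works for all k^m labelings at once. The choice is derandomized greedily. If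
-- each labeling is hit by a fraction 1/a of all vectors, then a · log₂ (k^m) + a vectors
-- suffice to hit all labelings. At least half of the vectors of {0,1}^m are rich for g, i.e. lie in
-- a class of equal sums of at least half the average size, so O(log₂ (k^m)) choices secure
-- one more rich vector for every g, and a part of the n choices secures about n / log₂ (k^m)
-- of them. If their sums are distinct, then a fraction of about 1/n (up to
-- logarithms) of all vectors repeats one of them, and hitting again yields a repetition
-- for every g.

module Submission where

open import Defs
open import Data.Bool using (Bool; true; false; not; T; if_then_else_)
open import Data.Bool.ListAction using (any)
open import Data.Empty using (⊥)
open import Data.Fin as Fin using (Fin; toℕ; fromℕ<)
open import Data.Fin.Properties using (any?; toℕ-fromℕ<; toℕ<n)
open import Data.Fin.Subset as Subset using (Subset; ⁅_⁆)
open import Data.Fin.Subset.Properties using (x∈⁅x⁆; x∈⁅y⁆⇒x≡y)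
open import Data.List
  using (List; []; _∷_; _++_; map; length; filter; filterᵇ; upTo; allFin; cartesianProductWith)
import Data.List as List
open import Data.List.Membership.Propositional using (_∈_; find)
open import Data.List.Membership.Propositional.Properties
  using (∈-∃++; ∈-upTo⁺; ∈-map⁺; ∈-filter⁺; ∈-filter⁻; ∈-++⁺ˡ; ∈-++⁺ʳ; ∈-lookup; ∈-allFin;
         ∈-cartesianProductWith⁺)
open import Data.List.Properties
  using (length-++; length-map; length-filter; length-upTo; length-tabulate; map-++; map-cong;
         map-tabulate; tabulate-lookup; ++-assoc)
open import Data.List.Relation.Binary.Permutation.Propositional
  using (_↭_; ↭-refl; ↭-trans; ↭-reflexive; ↭⇒↭ₛ)
open import Data.List.Relation.Binary.Permutation.Propositional.Properties
  using (map⁺; ↭-length; shift; ++⁺ˡ; ∈-resp-↭)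
import Data.List.Relation.Binary.Permutation.Setoid.Properties as PermS
open import Data.List.Relation.Unary.All using ([]; _∷_)
import Data.List.Relation.Unary.All as All
import Data.List.Relation.Unary.All.Properties as All
open import Data.List.Relation.Unary.AllPairs using ([]; _∷_)
open import Data.List.Relation.Unary.Any using (Any; here; there)
import Data.List.Relation.Unary.Any as Any
import Data.List.Relation.Unary.Any.Properties as Any
open import Data.List.Relation.Unary.Unique.Propositional using (Unique)
import Data.List.Relation.Unary.Unique.Propositional.Properties as Unique
open import Data.Nat
open import Data.Nat.DivMod using (_/_; _%_; m≡m%n+[m/n]*n; m%n<n; m/n*n≤m; m≥n⇒m/n>0)
open import Data.Nat.ListAction using (sum)
open import Data.Nat.ListAction.Properties using (sum-++; sum-↭)
open import Data.Nat.Properties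
open import Data.Nat.Tactic.RingSolver using (solve-∀)
open import Data.List.Relation.Unary.Unique.DecPropositional _≟_ using (unique?)
open import Data.Product using (∃; ∃₂; Σ; _×_; _,_; proj₁; proj₂)
open import Data.Sum using (_⊎_; inj₁; inj₂)
open import Data.Unit using (tt)
open import Data.Vec using (Vec; []; _∷_; lookup)
import Data.Vec as Vec
open import Data.Vec.Properties using (∷-injective; lookup∘tabulate; []=⇒lookup; lookup⇒[]=)
open import Function using (_∘_)
open import Relation.Binary.PropositionalEquality
open import Relation.Nullary using (¬_; yes; no; contradiction)

private variable
  X Y G A : Set

-- Sums and counts over lists.

sumOf : (X → ℕ) → List X → ℕ
sumOf h xs = sum (map h xs)

𝟙 : Bool → ℕ
𝟙 true  = 1
𝟙 false = 0

count : (X → Bool) → List X → ℕ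
count p = sumOf (𝟙 ∘ p)

sumOf-++ : ∀ (h : X → ℕ) xs ys → sumOf h (xs ++ ys) ≡ sumOf h xs + sumOf h ys
sumOf-++ h xs ys = trans (cong sum (map-++ h xs ys)) (sum-++ (map h xs) (map h ys))

sumOf-↭ : ∀ (h : X → ℕ) {xs ys} → xs ↭ ys → sumOf h xs ≡ sumOf h ys
sumOf-↭ h p = sum-↭ (map⁺ h p)

sumOf-mono : ∀ {h k : X → ℕ} xs → (∀ {x} → x ∈ xs → h x ≤ k x) → sumOf h xs ≤ sumOf k xs
sumOf-mono []       h≤k = z≤n
sumOf-mono (x ∷ xs) h≤k = +-mono-≤ (h≤k (here refl)) (sumOf-mono xs (h≤k ∘ there))

sumOf-const : ∀ c (xs : List X) → sumOf (λ _ → c) xs ≡ length xs * c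
sumOf-const c []       = refl
sumOf-const c (x ∷ xs) = cong (c +_) (sumOf-const c xs)

sumOf-* : ∀ c (h : X → ℕ) xs → sumOf (λ x → c * h x) xs ≡ c * sumOf h xs
sumOf-* c h []       = sym (*-zeroʳ c)
sumOf-* c h (x ∷ xs) =
  trans (cong (c * h x +_) (sumOf-* c h xs)) (sym (*-distribˡ-+ c (h x) (sumOf h xs)))

sumOf-+ : ∀ (h k : X → ℕ) xs → sumOf (λ x → h x + k x) xs ≡ sumOf h xs + sumOf k xs
sumOf-+ h k []       = refl
sumOf-+ h k (x ∷ xs) =
  trans (cong (h x + k x +_) (sumOf-+ h k xs)) (interchange (h x) (k x) _ _)
  where
  interchange : ∀ a b c d → (a + b) + (c + d) ≡ (a + c) + (b + d)
  interchange = solve-∀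

sumOf-swap : ∀ (h : X → Y → ℕ) xs ys →
  sumOf (λ x → sumOf (h x) ys) xs ≡ sumOf (λ y → sumOf (λ x → h x y) xs) ys
sumOf-swap h []       ys = sym (trans (sumOf-const 0 ys) (*-zeroʳ (length ys)))
sumOf-swap h (x ∷ xs) ys =
  trans (cong (sumOf (h x) ys +_) (sumOf-swap h xs ys))
        (sym (sumOf-+ (h x) (λ y → sumOf (λ x′ → h x′ y) xs) ys))

term≤sumOf : ∀ (h : X → ℕ) {x xs} → x ∈ xs → h x ≤ sumOf h xs
term≤sumOf h (here refl) = m≤m+n _ _
term≤sumOf h {xs = y ∷ _} (there x∈) = ≤-trans (term≤sumOf h x∈) (m≤n+m _ (h y))

𝟙≤1 : ∀ b → 𝟙 b ≤ 1
𝟙≤1 true  = ≤-refl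
𝟙≤1 false = z≤n

count≤length : ∀ (p : X → Bool) xs → count p xs ≤ length xs
count≤length p xs = begin
  count p xs             ≤⟨ sumOf-mono xs (λ {x} _ → 𝟙≤1 (p x)) ⟩
  sumOf (λ _ → 1) xs     ≡⟨ sumOf-const 1 xs ⟩
  length xs * 1          ≡⟨ *-identityʳ (length xs) ⟩
  length xs              ∎
  where open ≤-Reasoning

count-not : ∀ (p : X → Bool) xs → count p xs + count (not ∘ p) xs ≡ length xs
count-not p []       = refl
count-not p (x ∷ xs) with p x
... | true  = cong suc (count-not p xs)
... | false = trans (+-suc _ _) (cong suc (count-not p xs))

length-filterᵇ-not : ∀ (p : X → Bool) xs →
  length (filterᵇ (not ∘ p) xs) + count p xs ≡ length xs
length-filterᵇ-not p []       = refl
length-filterᵇ-not p (x ∷ xs) with p x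
... | true  = trans (+-suc _ _) (cong suc (length-filterᵇ-not p xs))
... | false = cong suc (length-filterᵇ-not p xs)

∈-filterᵇ-not : ∀ (p : X → Bool) {x xs} → x ∈ xs → T (p x) ⊎ x ∈ filterᵇ (not ∘ p) xs
∈-filterᵇ-not p {x} (here refl) with p x
... | true  = inj₁ tt
... | false = inj₂ (here refl)
∈-filterᵇ-not p {xs = y ∷ _} (there x∈) with p y | ∈-filterᵇ-not p x∈
... | _     | inj₁ px = inj₁ px
... | true  | inj₂ x∈′ = inj₂ x∈′
... | false | inj₂ x∈′ = inj₂ (there x∈′)

∈-filterᵇ⇒∈ : ∀ (p : X → Bool) {x} xs → x ∈ filterᵇ p xs → x ∈ xs
∈-filterᵇ⇒∈ p (y ∷ ys) x∈ with p y
... | false = there (∈-filterᵇ⇒∈ p ys x∈)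
∈-filterᵇ⇒∈ p (y ∷ ys) (here eq)  | true = here eq
∈-filterᵇ⇒∈ p (y ∷ ys) (there x∈) | true = there (∈-filterᵇ⇒∈ p ys x∈)

some≥average : ∀ (h : X → ℕ) xs → 0 < length xs →
  ∃ λ v → v ∈ xs × sumOf h xs ≤ length xs * h v
some≥average h (x ∷ [])     _ = x , here refl , ≤-refl
some≥average h (x ∷ y ∷ ys) _
  with v , v∈ , sum≤ ← some≥average h (y ∷ ys) (s≤s z≤n)
  with ≤-total (h x) (h v)
... | inj₁ hx≤hv = v , there v∈ , +-mono-≤ hx≤hv sum≤
... | inj₂ hv≤hx = x , here refl ,
      +-monoʳ-≤ (h x) (≤-trans sum≤ (*-monoʳ-≤ (length (y ∷ ys)) hv≤hx))

-- Greedy choice of a hitting set.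

-- The list C of vectors chosen so far and the pool U′ of vectors still available
-- partition U throughout.
module Greedy (U : List X) where

  N : ℕ
  N = length U

  count-pool : ∀ (p : X → Bool) {M} C U′ → U ↭ C ++ U′ → length C ≤ M →
    count p U ≤ M + count p U′
  count-pool p {M} C U′ U↭ C≤M = begin
    count p U               ≡⟨ sumOf-↭ (𝟙 ∘ p) U↭ ⟩
    count p (C ++ U′)       ≡⟨ sumOf-++ (𝟙 ∘ p) C U′ ⟩
    count p C + count p U′  ≤⟨ +-monoˡ-≤ _ (≤-trans (count≤length p C) C≤M) ⟩
    M + count p U′          ∎
    where open ≤-Reasoning

  length-pool : ∀ C U′ → U ↭ C ++ U′ → N ≡ length C + length U′
  length-pool C U′ U↭ = trans (↭-length U↭) (length-++ C)

  pool-nonempty : ∀ C U′ → U ↭ C ++ U′ → length C < N → 0 < length U′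
  pool-nonempty C U′ U↭ C<N = +-cancelˡ-≤ (length C) _ _ (begin
    length C + 1          ≡⟨ +-comm (length C) 1 ⟩
    suc (length C)        ≤⟨ C<N ⟩
    N                     ≡⟨ length-pool C U′ U↭ ⟩
    length C + length U′  ∎)
    where open ≤-Reasoning

  -- Averaging. With `a = suc b`, each labeling in `S` is hit by at least `N / a + M` vectors of
  -- `U`; at most `M` of them lie in `C`, so `N / a` remain in the pool. Double counting the pairs
  -- (vector, labeling) gives a pool vector hitting a fraction `1 / a` of `S`. The reserve `M` lets
  -- the hypothesis refer to the fixed `U` instead of the shrinking pool.
  best-choice : ∀ (P : X → G → Bool) b M C U′ (S : List G) →
    U ↭ C ++ U′ → length C ≤ M → 0 < length U′ →
    (∀ {g} → g ∈ S → N + suc b * M ≤ suc b * count (λ v → P v g) U) →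
    ∃ λ v → v ∈ U′ × suc b * length (filterᵇ (not ∘ P v) S) ≤ b * length S
  best-choice P b M C U′ S U↭ C≤M U′≢[] hits
    with v , v∈ , avg ← some≥average (λ v → count (P v) S) U′ U′≢[] =
    v , v∈ , +-cancelˡ-≤ (length S) _ _ (begin
      length S + a * rest           ≤⟨ +-monoˡ-≤ (a * rest) S≤ ⟩
      a * count (P v) S + a * rest  ≡⟨ *-distribˡ-+ a (count (P v) S) rest ⟨
      a * (count (P v) S + rest)    ≡⟨ cong (a *_) (+-comm (count (P v) S) rest) ⟩
      a * (rest + count (P v) S)    ≡⟨ cong (a *_) (length-filterᵇ-not (P v) S) ⟩
      length S + b * length S       ∎)
    where
    open ≤-Reasoning
    a = suc b
    rest = length (filterᵇ (not ∘ P v) S)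
    pool≤N : length U′ ≤ N
    pool≤N = ≤-trans (m≤n+m _ (length C)) (≤-reflexive (sym (length-pool C U′ U↭)))
    instance
      N≢0 : NonZero N
      N≢0 = >-nonZero (≤-trans U′≢[] pool≤N)
    hits-pool : ∀ {g} → g ∈ S → N ≤ a * count (λ v → P v g) U′
    hits-pool {g} g∈ = +-cancelʳ-≤ (a * M) _ _ (begin
      N + a * M                            ≤⟨ hits g∈ ⟩
      a * count (λ v → P v g) U            ≤⟨ *-monoʳ-≤ a (count-pool _ C U′ U↭ C≤M) ⟩
      a * (M + count (λ v → P v g) U′)     ≡⟨ *-distribˡ-+ a M _ ⟩
      a * M + a * count (λ v → P v g) U′   ≡⟨ +-comm (a * M) _ ⟩
      a * count (λ v → P v g) U′ + a * M   ∎)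
    exchange : ∀ a n c → a * (n * c) ≡ n * (a * c)
    exchange = solve-∀
    S≤ : length S ≤ a * count (P v) S
    S≤ = *-cancelˡ-≤ N (begin
      N * length S                                 ≡⟨ *-comm N (length S) ⟩
      length S * N                                 ≡⟨ sumOf-const N S ⟨
      sumOf (λ _ → N) S                            ≤⟨ sumOf-mono S hits-pool ⟩
      sumOf (λ g → a * count (λ v → P v g) U′) S   ≡⟨ sumOf-* a _ S ⟩
      a * sumOf (λ g → count (λ v → P v g) U′) S   ≡⟨ cong (a *_) (sumOf-swap (λ g v → 𝟙 (P v g)) S U′) ⟩
      a * sumOf (λ v → count (P v) S) U′           ≤⟨ *-monoʳ-≤ a avg ⟩
      a * (length U′ * count (P v) S)              ≤⟨ *-monoʳ-≤ a (*-monoˡ-≤ _ pool≤N) ⟩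
      a * (N * count (P v) S)                      ≡⟨ exchange a N _ ⟩
      N * (a * count (P v) S)                      ∎)

  remove : ∀ C {U′ v} → U ↭ C ++ U′ → v ∈ U′ → ∃ λ U″ → U ↭ (v ∷ C) ++ U″
  remove C {v = v} U↭ v∈ with ys , zs , refl ← ∈-∃++ v∈ =
    ys ++ zs , ↭-trans U↭ (↭-trans (++⁺ˡ C (shift v ys zs)) (shift v C (ys ++ zs)))

  -- Each choice multiplies the number of labelings not yet hit by at most `b / suc b`, so after `t`
  -- choices fewer than one is left.
  greedy : ∀ (P : X → G → Bool) b M t C U′ (S : List G) →
    U ↭ C ++ U′ → t + length C ≤ M → M ≤ N →
    (∀ {g} → g ∈ S → N + suc b * M ≤ suc b * count (λ v → P v g) U) →
    length S * b ^ t < suc b ^ t →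
    ∃₂ λ D U″ → length D ≡ t × U ↭ (D ++ C) ++ U″ ×
      (∀ {g} → g ∈ S → Any (λ v → T (P v g)) D)
  -- For `t = 0` the last hypothesis reads `length S * 1 < 1`, so `S` is empty.
  greedy P b M zero C U′ []      U↭ _ _ _ _ = [] , U′ , refl , U↭ , λ ()
  greedy P b M zero C U′ (g ∷ S) U↭ _ _ _ (s≤s ())
  greedy P b M (suc t) C U′ S U↭ len≤M M≤N hits small
    with v , v∈ , shrink ← best-choice P b M C U′ S U↭
           (≤-trans (m≤n+m (length C) (suc t)) len≤M)
           (pool-nonempty C U′ U↭ (≤-trans (s≤s (m≤n+m (length C) t)) (≤-trans len≤M M≤N))) hits
    with U₁ , U↭₁ ← remove C U↭ v∈
    with D , U″ , |D| , U↭″ , hit ← greedy P b M t (v ∷ C) U₁ (filterᵇ (not ∘ P v) S) U↭₁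
           (≤-trans (≤-reflexive (+-suc t (length C))) len≤M) M≤N
           (λ g∈ → hits (∈-filterᵇ⇒∈ _ S g∈))
           (*-cancelˡ-< (suc b) _ _ (let open ≤-Reasoning in begin-strict
             suc b * (length (filterᵇ (not ∘ P v) S) * b ^ t)
               ≡⟨ *-assoc (suc b) (length (filterᵇ (not ∘ P v) S)) _ ⟨
             suc b * length (filterᵇ (not ∘ P v) S) * b ^ t    ≤⟨ *-monoˡ-≤ (b ^ t) shrink ⟩
             b * length S * b ^ t          ≡⟨ cong (_* b ^ t) (*-comm b (length S)) ⟩
             length S * b * b ^ t          ≡⟨ *-assoc (length S) b (b ^ t) ⟩
             length S * (b * b ^ t)        <⟨ small ⟩
             suc b * suc b ^ t             ∎))
    = D ++ v ∷ [] , U″ ,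
      trans (length-++ D) (trans (+-comm (length D) 1) (cong suc |D|)) ,
      ↭-trans U↭″ (↭-reflexive (cong (_++ U″) (sym (++-assoc D (v ∷ []) C)))) ,
      λ g∈ → hit′ (∈-filterᵇ-not (P v) g∈) hit
    where
    hit′ : ∀ {g} → T (P v g) ⊎ g ∈ filterᵇ (not ∘ P v) S →
      (g ∈ filterᵇ (not ∘ P v) S → Any (λ v → T (P v g)) D) →
      Any (λ v → T (P v g)) (D ++ v ∷ [])
    hit′ (inj₁ p)  _   = Any.++⁺ʳ D (here p)
    hit′ (inj₂ g∈) hit = Any.++⁺ˡ (hit g∈)

-- Exponential decay in natural numbers.

^-distribʳ-* : ∀ o m n → (m * n) ^ o ≡ m ^ o * n ^ o
^-distribʳ-* zero    m n = refl
^-distribʳ-* (suc o) m n =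
  trans (cong (m * n *_) (^-distribʳ-* o m n)) (interchange m n (m ^ o) (n ^ o))
  where
  interchange : ∀ a b c d → (a * b) * (c * d) ≡ (a * c) * (b * d)
  interchange = solve-∀

-- Bernoulli's inequality for (1 + 1/b)^t, cleared of denominators.
bernoulli : ∀ b t → b ^ t * (b + t) ≤ suc b ^ t * b
bernoulli b zero    = ≤-reflexive (cong (1 *_) (+-identityʳ b))
bernoulli b (suc t) = begin
  b * b ^ t * (b + suc t)    ≤⟨ m≤m+n _ (b ^ t * t) ⟩
  b * b ^ t * (b + suc t) + b ^ t * t ≡⟨ rearrange b (b ^ t) t ⟩
  suc b * (b ^ t * (b + t))  ≤⟨ *-monoʳ-≤ (suc b) (bernoulli b t) ⟩
  suc b * (suc b ^ t * b)    ≡⟨ *-assoc (suc b) (suc b ^ t) b ⟨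
  suc b * suc b ^ t * b      ∎
  where
  open ≤-Reasoning
  rearrange : ∀ b p t → b * p * (b + suc t) + p * t ≡ suc b * (p * (b + t))
  rearrange = solve-∀

-- Bernoulli at `t = b` gives `(1 + 1/b)^b ≥ 2`: a block of `suc b` greedy choices at least halves
-- the labelings not yet hit.
decay : ∀ b .{{_ : NonZero b}} → 2 * b ^ suc b ≤ suc b ^ suc b
decay b = begin
  2 * (b * b ^ b)    ≡⟨ double b (b ^ b) ⟩
  b ^ b * (b + b)    ≤⟨ bernoulli b b ⟩
  suc b ^ b * b      ≤⟨ *-monoʳ-≤ (suc b ^ b) (n≤1+n b) ⟩
  suc b ^ b * suc b  ≡⟨ *-comm (suc b ^ b) (suc b) ⟩
  suc b * suc b ^ b  ∎
  where
  open ≤-Reasoning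
  double : ∀ b p → 2 * (b * p) ≡ p * (b + b)
  double = solve-∀

-- `L` blocks of `suc b` choices halve `s < 2 ^ L` at least `L` times. This supplies the last
-- hypothesis of `greedy`.
decay-below-1 : ∀ {s} b L .{{_ : NonZero b}} → s < 2 ^ L →
  s * b ^ (suc b * L) < suc b ^ (suc b * L)
decay-below-1 {s} b L s< = begin-strict
  s * b ^ (suc b * L)         <⟨ *-monoˡ-< (b ^ (suc b * L)) s< ⟩
  2 ^ L * b ^ (suc b * L)     ≡⟨ cong (2 ^ L *_) (^-*-assoc b (suc b) L) ⟨
  2 ^ L * (b ^ suc b) ^ L     ≡⟨ ^-distribʳ-* L 2 (b ^ suc b) ⟨
  (2 * b ^ suc b) ^ L         ≤⟨ ^-monoˡ-≤ L (decay b) ⟩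
  (suc b ^ suc b) ^ L         ≡⟨ ^-*-assoc (suc b) (suc b) L ⟩
  suc b ^ (suc b * L)         ∎
  where
  open ≤-Reasoning
  instance _ = m^n≢0 b (suc b * L)

-- Repetition-free concatenations.

Unique-++⁻ʳ : ∀ (xs : List X) {ys} → Unique (xs ++ ys) → Unique ys
Unique-++⁻ʳ []       u       = u
Unique-++⁻ʳ (x ∷ xs) (_ ∷ u) = Unique-++⁻ʳ xs u

Unique-++⁻ˡ : ∀ (xs : List X) {ys} → Unique (xs ++ ys) → Unique xs
Unique-++⁻ˡ []       u        = []
Unique-++⁻ˡ (x ∷ xs) (x∉ ∷ u) = All.++⁻ˡ xs x∉ ∷ Unique-++⁻ˡ xs u

Unique-++⇒disjoint : ∀ (xs : List X) {ys x} → Unique (xs ++ ys) → x ∈ xs → x ∈ ys → ⊥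
Unique-++⇒disjoint (x ∷ xs) (x∉ ∷ _) (here refl) x∈ys = All.lookup (All.++⁻ʳ xs x∉) x∈ys refl
Unique-++⇒disjoint (x ∷ xs) (_ ∷ u)  (there x∈)  x∈ys = Unique-++⇒disjoint xs u x∈ x∈ys

Unique-map-++⁻ʳ : ∀ (h : X → Y) xs {ys} → Unique (map h (xs ++ ys)) → Unique (map h ys)
Unique-map-++⁻ʳ h xs {ys} u = Unique-++⁻ʳ (map h xs) (subst Unique (map-++ h xs ys) u)

Unique-map-++⁻ˡ : ∀ (h : X → Y) xs {ys} → Unique (map h (xs ++ ys)) → Unique (map h xs)
Unique-map-++⁻ˡ h xs {ys} u = Unique-++⁻ˡ (map h xs) (subst Unique (map-++ h xs ys) u)

length-++₃ : ∀ (xs ys zs : List X) {a b} → length xs ≡ a → length ys ≡ b →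
  length (xs ++ ys ++ zs) ≡ a + (b + length zs)
length-++₃ xs ys zs |xs| |ys| =
  trans (length-++ xs) (cong₂ _+_ |xs| (trans (length-++ ys) (cong (_+ length zs) |ys|)))

-- Rich vectors and forced collisions.

0<𝟙 : ∀ {b} → T b → 1 ≤ 𝟙 b
0<𝟙 {true} _ = s≤s z≤n

any⇒1≤count : ∀ (p : X → Bool) {xs} → Any (T ∘ p) xs → 1 ≤ count p xs
any⇒1≤count p any with x , x∈ , px ← find any = ≤-trans (0<𝟙 px) (term≤sumOf (𝟙 ∘ p) x∈)

module Collisions (U : List X) (f : G → X → ℕ) (B : ℕ) .{{_ : NonZero B}}
                  (f<B : ∀ g v → f g v < B) where

  open Greedy U

  class : G → ℕ → ℕ
  class g y = count (λ u → f g u ≡ᵇ y) U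

  -- There are `B` possible sums, so `N / B` is the average class size; the threshold is half of it,
  -- cleared of division.
  rich : X → G → Bool
  rich v g = N ≤ᵇ 2 * B * class g (f g v)

  collides : List X → X → G → Bool
  collides A v g = any (λ a → f g v ≡ᵇ f g a) A

  -- Each of the at most `B` poor classes has at most `N / (2 * B)` members, so at most half of all
  -- vectors are poor.
  count-rich : ∀ g → N ≤ 2 * count (λ v → rich v g) U
  count-rich g = +-cancelʳ-≤ N _ _ (begin
    N + N              ≡⟨ cong (N +_) (+-identityʳ N) ⟨
    2 * N              ≡⟨ cong (2 *_) (count-not (λ v → rich v g) U) ⟨
    2 * (R + P)        ≡⟨ *-distribˡ-+ 2 R P ⟩
    2 * R + 2 * P      ≤⟨ +-monoʳ-≤ (2 * R) 2P≤N ⟩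
    2 * R + N          ∎)
    where
    open ≤-Reasoning
    R = count (λ v → rich v g) U
    P = count (λ v → not (rich v g)) U
    poor : ℕ → ℕ
    poor y = 𝟙 (not (N ≤ᵇ 2 * B * class g y))
    poor-class : ∀ y → 2 * B * (poor y * class g y) ≤ N
    poor-class y with N ≤ᵇ 2 * B * class g y in eq
    ... | true  = ≤-trans (≤-reflexive (*-zeroʳ (2 * B))) z≤n
    ... | false = ≤-trans (≤-reflexive (cong (2 * B *_) (*-identityˡ (class g y))))
                    (≰⇒≥ λ N≤ → subst T eq (≤⇒≤ᵇ N≤))
    -- The term `y = f g v`, which is in range because sums are below `B`, already suffices.
    classify : ∀ {v} → v ∈ U → 𝟙 (not (rich v g)) ≤ sumOf (λ y → poor y * 𝟙 (f g v ≡ᵇ y)) (upTo B)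
    classify {v} _ = begin
      poor (f g v)                                 ≡⟨ *-identityʳ _ ⟨
      poor (f g v) * 1                             ≤⟨ *-monoʳ-≤ (poor (f g v)) (0<𝟙 (≡⇒≡ᵇ (f g v) _ refl)) ⟩
      poor (f g v) * 𝟙 (f g v ≡ᵇ f g v)
        ≤⟨ term≤sumOf (λ y → poor y * 𝟙 (f g v ≡ᵇ y)) (∈-upTo⁺ (f<B g v)) ⟩
      sumOf (λ y → poor y * 𝟙 (f g v ≡ᵇ y)) (upTo B)  ∎
    exchange : ∀ b p → b * (2 * p) ≡ 2 * b * p
    exchange = solve-∀
    2P≤N : 2 * P ≤ N
    2P≤N = *-cancelˡ-≤ B (begin
      B * (2 * P)
        ≡⟨ exchange B P ⟩
      2 * B * P
        ≤⟨ *-monoʳ-≤ (2 * B) (sumOf-mono U classify) ⟩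
      2 * B * sumOf (λ v → sumOf (λ y → poor y * 𝟙 (f g v ≡ᵇ y)) (upTo B)) U
        ≡⟨ cong (2 * B *_) (sumOf-swap (λ v y → poor y * 𝟙 (f g v ≡ᵇ y)) U (upTo B)) ⟩
      2 * B * sumOf (λ y → sumOf (λ v → poor y * 𝟙 (f g v ≡ᵇ y)) U) (upTo B)
        ≡⟨ sumOf-* (2 * B) _ (upTo B) ⟨
      sumOf (λ y → 2 * B * sumOf (λ v → poor y * 𝟙 (f g v ≡ᵇ y)) U) (upTo B)
        ≤⟨ sumOf-mono (upTo B) (λ {y} _ → ≤-trans
             (≤-reflexive (cong (2 * B *_) (sumOf-* (poor y) (λ v → 𝟙 (f g v ≡ᵇ y)) U)))
             (poor-class y)) ⟩
      sumOf (λ _ → N) (upTo B)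
        ≡⟨ sumOf-const N (upTo B) ⟩
      length (upTo B) * N
        ≡⟨ cong (_* N) (length-upTo B) ⟩
      B * N ∎)

  -- With this bound, summing class sizes over the members of `A` counts no colliding vector twice.
  multiplicity≤1 : ∀ g x A → Unique (map (f g) A) →
    count (λ a → x ≡ᵇ f g a) A ≤ 𝟙 (any (λ a → x ≡ᵇ f g a) A)
  multiplicity≤1 g x []      _        = z≤n
  multiplicity≤1 g x (a ∷ A) (a∉ ∷ u) with x ≡ᵇ f g a in eq
  ... | false = multiplicity≤1 g x A u
  ... | true  = s≤s (≤-trans (sumOf-mono A none) (≤-reflexive (trans (sumOf-const 0 A) (*-zeroʳ (length A)))))
    where
    none : ∀ {a′} → a′ ∈ A → 𝟙 (x ≡ᵇ f g a′) ≤ 0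
    none {a′} a′∈ with x ≡ᵇ f g a′ in eq′
    ... | false = z≤n
    ... | true  = contradiction
      (trans (sym (≡ᵇ⇒≡ x _ (subst T (sym eq) tt))) (≡ᵇ⇒≡ x _ (subst T (sym eq′) tt)))
      (All.lookup a∉ (∈-map⁺ (f g) a′∈))

  -- The classes of the `t` rich members are disjoint because the sums on `A` are distinct. Together
  -- they contain at least `t * N / (2 * B) = N / (2 * c)` vectors, all of which collide with `A`.
  count-collides : ∀ t c A g .{{_ : NonZero t}} → B ≡ c * t →
    Unique (map (f g) A) → t ≤ count (λ a → rich a g) A →
    N ≤ 2 * c * count (λ v → collides A v g) U
  count-collides t c A g B≡ uniq t≤ = *-cancelˡ-≤ t (begin
    t * N
      ≤⟨ *-monoˡ-≤ N t≤ ⟩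
    count (λ a → rich a g) A * N
      ≡⟨ *-comm _ N ⟩
    N * count (λ a → rich a g) A
      ≡⟨ sumOf-* N _ A ⟨
    sumOf (λ a → N * 𝟙 (rich a g)) A
      ≤⟨ sumOf-mono A (λ {a} _ → rich-class a) ⟩
    sumOf (λ a → 2 * B * class g (f g a)) A
      ≡⟨ sumOf-* (2 * B) _ A ⟩
    2 * B * sumOf (λ a → class g (f g a)) A
      ≡⟨ cong (2 * B *_) (sumOf-swap (λ a u → 𝟙 (f g u ≡ᵇ f g a)) A U) ⟩
    2 * B * sumOf (λ u → count (λ a → f g u ≡ᵇ f g a) A) U
      ≤⟨ *-monoʳ-≤ (2 * B) (sumOf-mono U (λ {u} _ → multiplicity≤1 g (f g u) A uniq)) ⟩
    2 * B * count (λ v → collides A v g) U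
      ≡⟨ cong (λ b → 2 * b * count (λ v → collides A v g) U) B≡ ⟩
    2 * (c * t) * count (λ v → collides A v g) U
      ≡⟨ exchange t c _ ⟩
    t * (2 * c * count (λ v → collides A v g) U) ∎)
    where
    open ≤-Reasoning
    exchange : ∀ t c k → 2 * (c * t) * k ≡ t * (2 * c * k)
    exchange = solve-∀
    rich-class : ∀ a → N * 𝟙 (rich a g) ≤ 2 * B * class g (f g a)
    rich-class a with N ≤ᵇ 2 * B * class g (f g a) in eq
    ... | true  = ≤-trans (≤-reflexive (*-identityʳ N)) (≤ᵇ⇒≤ N _ (subst T (sym eq) tt))
    ... | false = ≤-trans (≤-reflexive (*-zeroʳ N)) z≤n

  -- t consecutive blocks of 4L vectors, each containing a rich vector for every labeling.
  rich-list : ∀ t L M C U′ (S : List G) → U ↭ C ++ U′ →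
    t * (4 * L) + length C ≤ M → M ≤ N → 4 * M ≤ N → length S < 2 ^ L →
    ∃₂ λ D U″ → length D ≡ t * (4 * L) × U ↭ (D ++ C) ++ U″ ×
      (∀ {g} → g ∈ S → t ≤ count (λ v → rich v g) D)
  rich-list zero    L M C U′ S U↭ _ _ _ _ = [] , U′ , refl , U↭ , λ _ → z≤n
  rich-list (suc t) L M C U′ S U↭ len≤M M≤N 4M≤N |S|<
    with D₁ , U₁ , |D₁| , U↭₁ , many ← rich-list t L M C U′ S U↭
           (≤-trans (+-monoˡ-≤ (length C) (m≤n+m _ (4 * L))) len≤M) M≤N 4M≤N |S|<
    -- Half of `U` is rich, and the reserve `M ≤ N / 4` leaves a quarter: hence `b = 3` and blocks
    -- of `4 * L`.
    with D₂ , U₂ , |D₂| , U↭₂ , one ← greedy rich 3 M (4 * L) (D₁ ++ C) U₁ S U↭₁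
           (≤-trans (≤-reflexive (trans (cong (4 * L +_) (trans (length-++ D₁) (cong (_+ length C) |D₁|)))
                                        (sym (+-assoc (4 * L) _ (length C))))) len≤M)
           M≤N
           (λ {g} _ → let open ≤-Reasoning in begin
             N + 4 * M                              ≤⟨ +-monoʳ-≤ N 4M≤N ⟩
             N + N                                  ≤⟨ +-mono-≤ (count-rich g) (count-rich g) ⟩
             2 * count (λ v → rich v g) U + 2 * count (λ v → rich v g) U
                                                    ≡⟨ *-distribʳ-+ (count (λ v → rich v g) U) 2 2 ⟨
             4 * count (λ v → rich v g) U           ∎)
           (decay-below-1 3 L |S|<)
    = D₂ ++ D₁ , U₂ , trans (length-++ D₂) (cong₂ _+_ |D₂| |D₁|) ,
      ↭-trans U↭₂ (↭-reflexive (cong (_++ U₂) (sym (++-assoc D₂ D₁ C)))) ,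
      λ {g} g∈ → ≤-trans (+-mono-≤ (any⇒1≤count (λ v → rich v g) (one g∈)) (many g∈))
                         (≤-reflexive (sym (sumOf-++ _ D₂ D₁)))

  collides⇒¬Unique : ∀ g A D {C} → Any (λ v → T (collides A v g)) D →
    ¬ Unique (map (f g) (D ++ A ++ C))
  collides⇒¬Unique g A D {C} hit uniq
    with d , d∈ , coll ← find hit
    with a , a∈ , eq ← find (Any.any⁻ (λ a → f g d ≡ᵇ f g a) A coll) =
    Unique-++⇒disjoint (map (f g) D) (subst Unique (map-++ (f g) D (A ++ C)) uniq)
      (∈-map⁺ (f g) d∈)
      (subst (_∈ map (f g) (A ++ C)) (sym (≡ᵇ⇒≡ _ _ eq)) (∈-map⁺ (f g) (∈-++⁺ˡ a∈)))

  -- Three phases on top of the prescribed vectors `C`: `D₁` collects `t` rich vectors for every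
  -- labeling, `D₂` repeats a sum of `D₁` wherever those are still distinct, and `D₃` pads the
  -- family to exactly `n` vectors.
  collision-family : ∀ t c L n C U′ (S : List G) .{{_ : NonZero t}} .{{_ : NonZero c}} →
    B ≡ c * t → U ↭ C ++ U′ →
    suc (4 * c) * L + (t * (4 * L) + length C) ≤ n → suc (4 * c) * n ≤ N → length S < 2 ^ L →
    ∃₂ λ V U″ → length V ≡ n × U ↭ V ++ U″ × (∀ {v} → v ∈ C → v ∈ V) ×
      (∀ {g} → g ∈ S → ¬ Unique (map (f g) V))
  collision-family t c L n C U′ S B≡ U↭ len≤n an≤N |S|<
    with D₁ , U₁ , |D₁| , U↭₁ , many ← rich-list t L n C U′ S U↭
           (≤-trans (m≤n+m _ (suc (4 * c) * L)) len≤n)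
           (≤-trans (m≤n*m n (suc (4 * c))) an≤N)
           (≤-trans (*-monoˡ-≤ n (≤-trans (m≤m*n 4 c) (n≤1+n (4 * c)))) an≤N) |S|<
    -- A fraction `1 / (2 * c)` of `U` collides, and half of it pays for the reserve `n`;
    -- `b = 4 * c` avoids a subtraction. Labelings with a repetition inside `D₁` are filtered out,
    -- being done already.
    with D₂ , U₂ , |D₂| , U↭₂ , hit ← greedy (collides D₁) (4 * c) n (suc (4 * c) * L) (D₁ ++ C) U₁
           (filter (λ g → unique? (map (f g) D₁)) S) U↭₁
           (≤-trans (≤-reflexive (cong (suc (4 * c) * L +_)
             (trans (length-++ D₁) (cong (_+ length C) |D₁|)))) len≤n)
           (≤-trans (m≤n*m n (suc (4 * c))) an≤N)
           (λ {g} g∈ → let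
               open ≤-Reasoning
               g∈S , uniq = ∈-filter⁻ (λ g → unique? (map (f g) D₁)) {xs = S} g∈
               k = count (λ v → collides D₁ v g) U
               N≤ = count-collides t c D₁ g B≡ uniq (many g∈S)
             in begin
             N + suc (4 * c) * n     ≤⟨ +-monoʳ-≤ N an≤N ⟩
             N + N                   ≤⟨ +-mono-≤ N≤ N≤ ⟩
             2 * c * k + 2 * c * k   ≡⟨ *-distribʳ-+ k (2 * c) (2 * c) ⟨
             (2 * c + 2 * c) * k     ≡⟨ cong (_* k) (*-distribʳ-+ c 2 2) ⟨
             4 * c * k               ≤⟨ *-monoˡ-≤ k (n≤1+n (4 * c)) ⟩
             suc (4 * c) * k         ∎)
           (decay-below-1 (4 * c) L {{m*n≢0 4 c}} (≤-<-trans (length-filter _ S) |S|<))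
    -- With no labelings to hit, `greedy` just draws pool vectors; `rich` and `0` are placeholders.
    with D₃ , U₃ , |D₃| , U↭₃ , _ ← greedy {G = G} rich 0 n (n ∸ length (D₂ ++ D₁ ++ C)) (D₂ ++ D₁ ++ C) U₂ []
           U↭₂ (≤-reflexive (m∸n+n≡m (≤-trans (≤-reflexive (length-++₃ D₂ D₁ C |D₂| |D₁|)) len≤n)))
           (≤-trans (m≤n*m n (suc (4 * c))) an≤N) (λ ()) (m^n>0 1 (n ∸ length (D₂ ++ D₁ ++ C)))
    = D₃ ++ D₂ ++ D₁ ++ C , U₃ ,
      trans (length-++ D₃) (trans (cong (_+ length (D₂ ++ D₁ ++ C)) |D₃|)
        (m∸n+n≡m (≤-trans (≤-reflexive (length-++₃ D₂ D₁ C |D₂| |D₁|)) len≤n))) ,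
      U↭₃ , ∈-++⁺ʳ D₃ ∘ ∈-++⁺ʳ D₂ ∘ ∈-++⁺ʳ D₁ ,
      λ {g} g∈ uniq → let uniq₂₁ = Unique-map-++⁻ʳ (f g) D₃ uniq in
        collides⇒¬Unique g D₁ D₂ (hit (∈-filter⁺ (λ g → unique? (map (f g) D₁)) g∈
          (Unique-map-++⁻ˡ (f g) D₁ (Unique-map-++⁻ʳ (f g) D₂ uniq₂₁)))) uniq₂₁

-- Enumeration of vectors and complements of lists.

vecs : List A → ∀ m → List (Vec A m)
vecs xs zero    = [] ∷ []
vecs xs (suc m) = cartesianProductWith _∷_ xs (vecs xs m)

length-cartesianProductWith : ∀ {A B C : Set} (f : A → B → C) xs ys →
  length (cartesianProductWith f xs ys) ≡ length xs * length ys
length-cartesianProductWith f []       ys = refl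
length-cartesianProductWith f (x ∷ xs) ys = trans (length-++ (map (f x) ys))
  (cong₂ _+_ (length-map (f x) ys) (length-cartesianProductWith f xs ys))

length-vecs : ∀ (xs : List A) m → length (vecs xs m) ≡ length xs ^ m
length-vecs xs zero    = refl
length-vecs xs (suc m) = trans (length-cartesianProductWith _∷_ xs (vecs xs m))
  (cong (length xs *_) (length-vecs xs m))

vecs-unique : ∀ {xs : List A} → Unique xs → ∀ m → Unique (vecs xs m)
vecs-unique u zero    = [] ∷ []
vecs-unique u (suc m) = Unique.cartesianProductWith⁺ _∷_ ∷-injective u (vecs-unique u m)

∈-vecs : ∀ {xs : List A} → (∀ x → x ∈ xs) → ∀ {m} (v : Vec A m) → v ∈ vecs xs m
∈-vecs all []      = here refl
∈-vecs all (x ∷ v) = ∈-cartesianProductWith⁺ _∷_ (all x) (∈-vecs all v)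

bools : List Bool
bools = true ∷ false ∷ []

bools-unique : Unique bools
bools-unique = ((λ ()) ∷ []) ∷ [] ∷ []

∈-bools : ∀ b → b ∈ bools
∈-bools true  = here refl
∈-bools false = there (here refl)

subsets : ∀ m → List (Subset m)
subsets = vecs bools

Unique-resp-↭ : ∀ {xs ys : List X} → xs ↭ ys → Unique xs → Unique ys
Unique-resp-↭ {X = X} p = PermS.Unique-resp-↭ (setoid X) (↭⇒↭ₛ p)

-- Produces the initial partition into chosen vectors and pool that the greedy choice starts from.
complement : ∀ {xs ys : List X} → Unique xs → (∀ {x} → x ∈ xs → x ∈ ys) →
  ∃ λ zs → ys ↭ xs ++ zs
complement {xs = []}     {ys} _ _ = ys , ↭-refl
complement {xs = x ∷ xs} (x∉ ∷ u) ⊆ys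
  with zs , ys↭ ← complement u (⊆ys ∘ there)
  with Any.++⁻ xs (∈-resp-↭ ys↭ (⊆ys (here refl)))
... | inj₁ x∈xs = contradiction refl (All.lookup x∉ x∈xs)
... | inj₂ x∈zs with as , bs , refl ← ∈-∃++ x∈zs =
  as ++ bs , ↭-trans ys↭ (↭-trans (++⁺ˡ xs (shift x as bs)) (shift x xs (as ++ bs)))

lookup-injective : ∀ {xs : List X} → Unique xs → ∀ {i j} →
  List.lookup xs i ≡ List.lookup xs j → i ≡ j
lookup-injective (_ ∷ _)  {Fin.zero}  {Fin.zero}  _  = refl
lookup-injective (x∉ ∷ _) {Fin.zero}  {Fin.suc j} eq = contradiction eq (All.lookup x∉ (∈-lookup j))
lookup-injective (x∉ ∷ _) {Fin.suc i} {Fin.zero}  eq = contradiction (sym eq) (All.lookup x∉ (∈-lookup i))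
lookup-injective (_ ∷ u)  {Fin.suc i} {Fin.suc j} eq = cong Fin.suc (lookup-injective u eq)

-- Vertex sums as dot products.

Σ<-cong : ∀ m {f h : Fin m → ℕ} → (∀ i → f i ≡ h i) → Σ< m f ≡ Σ< m h
Σ<-cong zero    f≗h = refl
Σ<-cong (suc m) f≗h = cong₂ _+_ (f≗h Fin.zero) (Σ<-cong m (f≗h ∘ Fin.suc))

dot : ∀ {m} → (Fin m → ℕ) → Subset m → ℕ
dot {m} g v = Σ< m (λ e → if lookup v e then g e else 0)

dot-cong : ∀ {m} {g h : Fin m → ℕ} → (∀ e → g e ≡ h e) → ∀ v → dot g v ≡ dot h v
dot-cong {m} g≗h v = Σ<-cong m (λ e → cong (if lookup v e then_else 0) (g≗h e))

-- Every label is at most `k - 1`. The `m` on the left avoids that subtraction and makes the sum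
-- strictly less than `m * k` when `m` is positive.
dot-bound : ∀ {m k} (g : Fin m → ℕ) → (∀ e → g e < k) → ∀ v → m + dot g v ≤ m * k
dot-bound g g<k [] = z≤n
dot-bound {suc m} {k} g g<k (b ∷ v) = begin
  suc m + (first b + dot (g ∘ Fin.suc) v)  ≡⟨ rearrange m (first b) _ ⟩
  suc (first b) + (m + dot (g ∘ Fin.suc) v)
    ≤⟨ +-mono-≤ (first< b) (dot-bound (g ∘ Fin.suc) (g<k ∘ Fin.suc) v) ⟩
  k + m * k                                 ∎
  where
  open ≤-Reasoning
  first : Bool → ℕ
  first b = if b then g Fin.zero else 0
  first< : ∀ b → first b < k
  first< true  = g<k Fin.zero
  first< false = ≤-<-trans z≤n (g<k Fin.zero)
  rearrange : ∀ m a d → suc m + (a + d) ≡ suc a + (m + d)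
  rearrange = solve-∀

dot-2* : ∀ {m} (g : Fin m → ℕ) v → dot (λ e → 2 * g e) v ≡ 2 * dot g v
dot-2* g []          = refl
dot-2* g (true ∷ v)  = trans (cong (2 * g Fin.zero +_) (dot-2* (g ∘ Fin.suc) v))
  (sym (*-distribˡ-+ 2 (g Fin.zero) _))
dot-2* g (false ∷ v) = dot-2* (g ∘ Fin.suc) v

-- Uniqueness of binary expansions: parity determines the first bit, and halving leaves the tail.
dot-2^-injective : ∀ {m} (u v : Subset m) →
  dot (λ e → 2 ^ toℕ e) u ≡ dot (λ e → 2 ^ toℕ e) v → u ≡ v
dot-2^-injective []      []      _  = refl
dot-2^-injective (b ∷ u) (c ∷ v) eq = step b c
  (subst₂ (λ x y → (if b then 1 else 0) + x ≡ (if c then 1 else 0) + y)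
    (dot-2* (λ e → 2 ^ toℕ e) u) (dot-2* (λ e → 2 ^ toℕ e) v) eq)
  where
  rec : 2 * dot (λ e → 2 ^ toℕ e) u ≡ 2 * dot (λ e → 2 ^ toℕ e) v → u ≡ v
  rec = dot-2^-injective u v ∘ *-cancelˡ-≡ _ _ 2
  step : ∀ b c → (if b then 1 else 0) + 2 * dot (λ e → 2 ^ toℕ e) u ≡
                 (if c then 1 else 0) + 2 * dot (λ e → 2 ^ toℕ e) v → b ∷ u ≡ c ∷ v
  step true  true  eq = cong (true ∷_) (rec (suc-injective eq))
  step false false eq = cong (false ∷_) (rec eq)
  step true  false eq = contradiction (sym eq) (even≢odd (dot (λ e → 2 ^ toℕ e) v) (dot (λ e → 2 ^ toℕ e) u))
  step false true  eq = contradiction eq (even≢odd (dot (λ e → 2 ^ toℕ e) u) (dot (λ e → 2 ^ toℕ e) v))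

-- From families of vectors to hypergraphs.

-- The vertices are the entries of V, the edges are the coordinates; the unit vectors in V
-- make the edges distinct.
module Incidence {m} (V : List (Subset m)) (units : ∀ e → ⁅ e ⁆ ∈ V) where

  row : Fin (length V) → Subset m
  row = List.lookup V

  hypergraph : Hypergraph (length V)
  hypergraph = record
    { m        = m
    ; edge     = edges
    ; edge-inj = λ {e} {e′} eq →
        -- The vertex `x` with row `⁅ e ⁆` lies in the edge `e` only, so an equal edge `e′` has the
        -- index `e`.
        let x = Any.index (units e)
            row-x : ⁅ e ⁆ ≡ row x
            row-x = Any.lookup-index (units e)
        in sym (x∈⁅y⁆⇒x≡y e (lookup⇒[]= e′ ⁅ e ⁆ (begin
          lookup ⁅ e ⁆ e′       ≡⟨ cong (λ r → lookup r e′) row-x ⟩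
          lookup (row x) e′     ≡⟨ lookup∘tabulate (λ y → lookup (row y) e′) x ⟨
          lookup (edges e′) x   ≡⟨ cong (λ s → lookup s x) eq ⟨
          lookup (edges e) x    ≡⟨ lookup∘tabulate (λ y → lookup (row y) e) x ⟩
          lookup (row x) e      ≡⟨ cong (λ r → lookup r e) row-x ⟨
          lookup ⁅ e ⁆ e        ≡⟨ []=⇒lookup (x∈⁅x⁆ e) ⟩
          true                  ∎)))
    }
    where
    open ≡-Reasoning
    edges : Fin m → Subset (length V)
    edges e = Vec.tabulate (λ x → lookup (row x) e)

  σ≡dot : ∀ (L : Labeling hypergraph) x → σ L x ≡ dot (g L) (row x)
  σ≡dot L x = Σ<-cong m (λ e →
    cong (if_then g L e else 0) (lookup∘tabulate (λ y → lookup (row y) e) x))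

  irregular⇒Unique : ∀ (L : Labeling hypergraph) → Irregular L → Unique (map (dot (g L)) V)
  irregular⇒Unique L irr = subst Unique
    (trans (sym (map-tabulate row (dot (g L)))) (cong (map (dot (g L))) (tabulate-lookup V)))
    (Unique.tabulate⁺ (λ {x} {y} eq → irr x y (trans (σ≡dot L x) (trans eq (sym (σ≡dot L y))))))

  binary : Labeling hypergraph
  binary = record { g = λ e → 2 ^ toℕ e ; pos = λ e → m^n>0 2 (toℕ e) }

  binary-irregular : Unique V → Irregular binary
  binary-irregular uniq x y eq = lookup-injective uniq (dot-2^-injective (row x) (row y)
    (trans (sym (σ≡dot binary x)) (trans eq (σ≡dot binary y))))

  -- A labeling with all labels below `k` is a vector over `Fin k`, where a collision is assumed;
  -- the binary labeling shows that an irregular one exists.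
  irr≥-incidence : ∀ k → Unique V →
    (∀ (g : Vec (Fin k) m) → ¬ Unique (map (dot (toℕ ∘ lookup g)) V)) → irr≥ (length V) k
  irr≥-incidence k uniq collision = hypergraph , (binary , binary-irregular uniq) , large
    where
    large : irrH≥ hypergraph k
    large L irr with any? (λ e → k ≤? g L e)
    ... | yes large = large
    ... | no ¬large = contradiction
      (subst Unique (map-cong (dot-cong label≡) V) (irregular⇒Unique L irr)) (collision labels)
      where
      small : ∀ e → g L e < k
      small e = ≰⇒> (λ k≤ → ¬large (e , k≤))
      labels : Vec (Fin k) m
      labels = Vec.tabulate (λ e → fromℕ< (small e))
      label≡ : ∀ e → g L e ≡ toℕ (lookup labels e)
      label≡ e = sym (trans (cong toℕ (lookup∘tabulate (λ e → fromℕ< (small e)) e))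
                            (toℕ-fromℕ< (small e)))

-- Here `k = t * t`, so sums lie below `B = m * (t * t) = c * t` with `c = m * t`. Both phases then
-- cost about `t` choices up to factors in `m` and `L`, which allows `t` near `n` and `k` near
-- `n * n`.
irr≥-finite : ∀ m t L n .{{_ : NonZero m}} .{{_ : NonZero t}} →
  suc (4 * (m * t)) * L + (t * (4 * L) + m) ≤ n → suc (4 * (m * t)) * n ≤ 2 ^ m →
  (t * t) ^ m < 2 ^ L → irr≥ n (t * t)
irr≥-finite m t L n len≤n an≤N |S|< = from-family
  (collision-family t (m * t) L n units (proj₁ pool) labels
    (sym (*-assoc m t t)) (proj₂ pool)
    (subst (λ l → suc (4 * (m * t)) * L + (t * (4 * L) + l) ≤ n) (sym |units|) len≤n)
    (subst (suc (4 * (m * t)) * n ≤_) (sym (length-vecs bools m)) an≤N)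
    (subst (_< 2 ^ L) (sym |labels|) |S|<))
  where
  instance
    _ = m*n≢0 m t
    _ = m*n≢0 t t
    _ = m*n≢0 m (t * t)
  units : List (Subset m)
  units = map ⁅_⁆ (allFin m)
  |units| : length units ≡ m
  |units| = trans (length-map ⁅_⁆ (allFin m)) (length-tabulate (λ (e : Fin m) → e))
  units-unique : Unique units
  units-unique = Unique.map⁺
    (λ {x} {y} eq → x∈⁅y⁆⇒x≡y y (subst (Subset._∈_ x) eq (x∈⁅x⁆ x))) (Unique.allFin⁺ m)
  pool : ∃ λ U′ → subsets m ↭ units ++ U′
  pool = complement units-unique (λ {v} _ → ∈-vecs ∈-bools v)
  labels : List (Vec (Fin (t * t)) m)
  labels = vecs (allFin (t * t)) m
  |labels| : length labels ≡ (t * t) ^ m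
  |labels| = trans (length-vecs (allFin (t * t)) m)
    (cong (_^ m) (length-tabulate (λ (i : Fin (t * t)) → i)))
  value : Vec (Fin (t * t)) m → Subset m → ℕ
  value g = dot (toℕ ∘ lookup g)
  value< : ∀ g v → value g v < m * (t * t)
  value< g v = <-≤-trans (m<n+m _ (>-nonZero⁻¹ m))
    (dot-bound (toℕ ∘ lookup g) (λ e → toℕ<n (lookup g e)) v)
  open Collisions (subsets m) value (m * (t * t)) value< using (collision-family)
  from-family : (∃₂ λ V W → length V ≡ n × subsets m ↭ V ++ W × (∀ {v} → v ∈ units → v ∈ V) ×
    (∀ {g} → g ∈ labels → ¬ Unique (map (value g) V))) → irr≥ n (t * t)
  from-family (V , W , refl , ↭V , units⊆V , collide) =
    Incidence.irr≥-incidence V (λ e → units⊆V (∈-map⁺ ⁅_⁆ (∈-allFin e))) (t * t)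
      (Unique-++⁻ˡ V (Unique-resp-↭ ↭V (vecs-unique bools-unique m)))
      (λ g → collide (∈-vecs ∈-allFin g))

-- Asymptotics and choice of parameters.

n<2^n : ∀ n → n < 2 ^ n
n<2^n zero    = s≤s z≤n
n<2^n (suc n) = begin-strict
  suc n          <⟨ s≤s (n<2^n n) ⟩
  1 + 2 ^ n      ≤⟨ +-monoˡ-≤ (2 ^ n) (m^n>0 2 n) ⟩
  2 ^ n + 2 ^ n  ≡⟨ cong (2 ^ n +_) (+-identityʳ (2 ^ n)) ⟨
  2 ^ suc n      ∎
  where open ≤-Reasoning

log₂-bracket : ∀ n → 0 < n → ∃ λ x → 2 ^ x ≤ n × n < 2 ^ suc x
log₂-bracket (suc zero)    _ = 0 , s≤s z≤n , s≤s (s≤s z≤n)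
log₂-bracket (suc (suc n)) _ with x , lower , upper ← log₂-bracket (suc n) (s≤s z≤n)
  with suc (suc n) <? 2 ^ suc x
... | yes below = x , m≤n⇒m≤1+n lower , below
... | no ¬below = suc x , ≮⇒≥ ¬below ,
      <-≤-trans (s≤s upper) (^-monoʳ-< 2 (s≤s (s≤s z≤n)) (n<1+n (suc x)))

-- With `y = x / e`, `x ≤ e * suc y ≤ e * 2 ^ y`; the `e`-th power has exponent `y * e ≤ x`.
power≤exp : ∀ e x .{{_ : NonZero e}} → x ^ e ≤ e ^ e * 2 ^ x
power≤exp e x = begin
  x ^ e                ≤⟨ ^-monoˡ-≤ e x≤ ⟩
  (e * 2 ^ y) ^ e      ≡⟨ ^-distribʳ-* e e (2 ^ y) ⟩
  e ^ e * (2 ^ y) ^ e  ≡⟨ cong (e ^ e *_) (^-*-assoc 2 y e) ⟩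
  e ^ e * 2 ^ (y * e)  ≤⟨ *-monoʳ-≤ (e ^ e) (^-monoʳ-≤ 2 (m/n*n≤m x e)) ⟩
  e ^ e * 2 ^ x        ∎
  where
  open ≤-Reasoning
  y = x / e
  x≤ : x ≤ e * 2 ^ y
  x≤ = begin
    x                ≡⟨ m≡m%n+[m/n]*n x e ⟩
    x % e + y * e    ≤⟨ +-monoˡ-≤ (y * e) (<⇒≤ (m%n<n x e)) ⟩
    suc y * e        ≤⟨ *-monoˡ-≤ e (n<2^n y) ⟩
    2 ^ y * e        ≡⟨ *-comm (2 ^ y) e ⟩
    e * 2 ^ y        ∎

-- One spare factor `x` in `power≤exp` at exponent `suc d` absorbs the constant.
poly≤exp : ∀ d x → suc d ^ suc d ≤ x → x ^ d ≤ 2 ^ x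
poly≤exp d x large = *-cancelˡ-≤ x (begin
  x * x ^ d                ≤⟨ power≤exp (suc d) x ⟩
  suc d ^ suc d * 2 ^ x    ≤⟨ *-monoˡ-≤ (2 ^ x) large ⟩
  x * 2 ^ x                ∎)
  where
  open ≤-Reasoning
  instance _ = >-nonZero (≤-trans (m^n>0 (suc d) (suc d)) large)

-- If `n < 2 ^ suc x`, then `2 ^ dim x = 8 * (2 ^ suc x) ^ 2` exceeds `8 * n ^ 2`, room enough for
-- the family.
dim : ℕ → ℕ
dim x = 2 * x + 5

-- The k ^ m labelings, where m = dim x and k = t * t < 2 ^ m, number less than 2 ^ rounds m.
rounds : ℕ → ℕ
rounds m = suc (m * m)

-- The construction uses at most width m * t vertices.
width : ℕ → ℕ
width m = rounds m * (4 * m + 5) + m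

-- `width` is cubic in `d = dim x`; `d ≥ 5` lets two more factors `d` absorb the constant 22, and
-- `d ≤ x ^ 2`.
width-poly : ∀ x → 4 ≤ x → 2 * width (dim x) ≤ x ^ 10
width-poly x 4≤x = begin
  2 * width d             ≤⟨ *-monoʳ-≤ 2 (+-mono-≤ (*-mono-≤ rounds≤ 4d+5≤) d≤d³) ⟩
  2 * (2 * (d * d) * (5 * d) + d * (d * d))  ≡⟨ collect d ⟩
  22 * (d * (d * d))      ≤⟨ *-monoˡ-≤ (d * (d * d)) 22≤d² ⟩
  d * d * (d * (d * d))   ≡⟨ fifth d ⟩
  d ^ 5                   ≤⟨ ^-monoˡ-≤ 5 d≤x² ⟩
  (x ^ 2) ^ 5             ≡⟨ ^-*-assoc x 2 5 ⟩
  x ^ 10                  ∎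
  where
  open ≤-Reasoning
  d = dim x
  5≤d : 5 ≤ d
  5≤d = m≤n+m 5 (2 * x)
  instance
    d≢0 : NonZero d
    d≢0 = >-nonZero (≤-trans (s≤s z≤n) 5≤d)
  25≤d² : 25 ≤ d * d
  25≤d² = *-mono-≤ 5≤d 5≤d
  22≤d² : 22 ≤ d * d
  22≤d² = ≤-trans (m≤m+n 22 3) 25≤d²
  d≤d³ : d ≤ d * (d * d)
  d≤d³ = m≤m*n d (d * d) {{m*n≢0 d d}}
  collect : ∀ m → 2 * (2 * (m * m) * (5 * m) + m * (m * m)) ≡ 22 * (m * (m * m))
  collect = solve-∀
  fifth : ∀ m → m * m * (m * (m * m)) ≡ m * (m * (m * (m * (m * 1))))
  fifth = solve-∀
  rounds≤ : rounds d ≤ 2 * (d * d)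
  rounds≤ = begin
    1 + d * d      ≤⟨ +-mono-≤ (≤-trans (s≤s z≤n) 22≤d²) (m≤m+n (d * d) 0) ⟩
    2 * (d * d)    ∎
  4d+5≤ : 4 * d + 5 ≤ 5 * d
  4d+5≤ = ≤-trans (+-monoʳ-≤ (4 * d) 5≤d) (≤-reflexive (+-comm (4 * d) d))
  d≤x² : d ≤ x ^ 2
  d≤x² = begin
    2 * x + 5      ≤⟨ +-monoʳ-≤ (2 * x) (≤-trans (m≤m+n 5 3) (*-monoʳ-≤ 2 4≤x)) ⟩
    2 * x + 2 * x  ≡⟨ *-distribʳ-+ x 2 2 ⟨
    4 * x          ≤⟨ *-monoˡ-≤ x 4≤x ⟩
    x * x          ≡⟨ cong (x *_) (*-identityʳ x) ⟨
    x ^ 2          ∎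

irr≥-square : ∀ x n t .{{_ : NonZero t}} → n < 2 ^ suc x → width (dim x) * t ≤ n → irr≥ n (t * t)
irr≥-square x n t n< Wt≤n = irr≥-finite d t (rounds d) n vertices vectors labelings
  where
  open ≤-Reasoning
  d = dim x
  L = rounds d
  instance
    d≢0 : NonZero d
    d≢0 = >-nonZero (≤-trans (s≤s z≤n) (m≤n+m 5 (2 * x)))
    dt≢0 : NonZero (d * t)
    dt≢0 = m*n≢0 d t
  vertices : suc (4 * (d * t)) * L + (t * (4 * L) + d) ≤ n
  vertices = begin
    suc (4 * (d * t)) * L + (t * (4 * L) + d)
      ≡⟨ split d t L ⟩
    L * (4 * d + 4) * t + (L + d)
      -- Enlarging the terms free of `t` by a factor `t` makes the bound a multiple of `t`.
      ≤⟨ +-monoʳ-≤ (L * (4 * d + 4) * t) (m≤m*n (L + d) t) ⟩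
    L * (4 * d + 4) * t + (L + d) * t
      ≡⟨ join d t L ⟩
    (L * (4 * d + 5) + d) * t
      ≤⟨ Wt≤n ⟩
    n ∎
    where
    split : ∀ m t L → suc (4 * (m * t)) * L + (t * (4 * L) + m) ≡ L * (4 * m + 4) * t + (L + m)
    split = solve-∀
    join : ∀ m t L → L * (4 * m + 4) * t + (L + m) * t ≡ (L * (4 * m + 5) + m) * t
    join = solve-∀
  dt≤n : d * t ≤ n
  dt≤n = ≤-trans (*-monoˡ-≤ t (m≤n+m d (L * (4 * d + 5)))) Wt≤n
  exponent : ∀ x → 3 + (suc x + suc x) ≡ 2 * x + 5
  exponent = solve-∀
  n²≤ : 8 * (n * n) ≤ 2 ^ d
  n²≤ = begin
    8 * (n * n)                    ≤⟨ *-monoʳ-≤ 8 (*-mono-≤ (<⇒≤ n<) (<⇒≤ n<)) ⟩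
    2 ^ 3 * (2 ^ suc x * 2 ^ suc x)  ≡⟨ cong (2 ^ 3 *_) (^-distribˡ-+-* 2 (suc x) (suc x)) ⟨
    2 ^ 3 * 2 ^ (suc x + suc x)    ≡⟨ ^-distribˡ-+-* 2 3 (suc x + suc x) ⟨
    2 ^ (3 + (suc x + suc x))      ≡⟨ cong (2 ^_) (exponent x) ⟩
    2 ^ d                          ∎
  vectors : suc (4 * (d * t)) * n ≤ 2 ^ d
  vectors = begin
    suc (4 * (d * t)) * n  ≤⟨ *-monoˡ-≤ n (+-monoˡ-≤ (4 * (d * t)) (>-nonZero⁻¹ (d * t))) ⟩
    5 * (d * t) * n        ≤⟨ *-monoˡ-≤ n (*-mono-≤ (m≤m+n 5 3) dt≤n) ⟩
    8 * n * n              ≡⟨ *-assoc 8 n n ⟩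
    8 * (n * n)            ≤⟨ n²≤ ⟩
    2 ^ d                  ∎
  labelings : (t * t) ^ d < 2 ^ L
  labelings = begin-strict
    (t * t) ^ d    ≤⟨ ^-monoˡ-≤ d (≤-trans (*-mono-≤ t≤n t≤n) (≤-trans (m≤n*m (n * n) 8) n²≤)) ⟩
    (2 ^ d) ^ d    ≡⟨ ^-*-assoc 2 d d ⟩
    2 ^ (d * d)    <⟨ ^-monoʳ-< 2 (s≤s (s≤s z≤n)) (n<1+n (d * d)) ⟩
    2 ^ L          ∎
    where
    t≤n : t ≤ n
    t≤n = ≤-trans (m≤n*m t d) dt≤n

-- `ε = suc p / suc q`: the inequality is `k ≥ n^(2-ε)` raised to the power `suc q`, free of real
-- exponents.
theorem5 : ∀ (p q : ℕ) → ∃ λ n₀ → ∀ n → n₀ < n →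
    Σ ℕ λ k → irr≥ n k × (n ^ (2 * suc q) ≤ (k ^ suc q) * (n ^ suc p))
theorem5 p q = 2 ^ x₀ , large-n
  where
  Q = 2 * suc q
  -- The 4 serves `width-poly`, the rest is the threshold of `poly≤exp` at exponent `10 * Q`.
  x₀ = 4 + suc (10 * Q) ^ suc (10 * Q)
  large-n : ∀ n → 2 ^ x₀ < n → Σ ℕ λ k → irr≥ n k × (n ^ Q ≤ (k ^ suc q) * (n ^ suc p))
  large-n n n₀<n = bracketed (log₂-bracket n (≤-trans (s≤s z≤n) n₀<n))
    where
    bracketed : (∃ λ x → 2 ^ x ≤ n × n < 2 ^ suc x) →
      Σ ℕ λ k → irr≥ n k × (n ^ Q ≤ (k ^ suc q) * (n ^ suc p))
    bracketed (x , lower , upper) =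
      t * t , irr≥-square x n t upper (≤-trans (≤-reflexive (*-comm W t)) (m/n*n≤m n W)) , bound
      where
      open ≤-Reasoning
      W = width (dim x)
      instance
        W≢0 : NonZero W
        W≢0 = >-nonZero (≤-trans (s≤s z≤n) (≤-trans (m≤n+m 5 (2 * x))
          (m≤n+m (dim x) (rounds (dim x) * (4 * dim x + 5)))))
        2W≢0 : NonZero (2 * W)
        2W≢0 = m*n≢0 2 W
      x₀≤x : x₀ ≤ x
      x₀≤x = ≮⇒≥ λ x<x₀ → <-irrefl refl
        (<-trans n₀<n (<-≤-trans upper (^-monoʳ-≤ 2 x<x₀)))
      width^Q≤n : (2 * W) ^ Q ≤ n
      width^Q≤n = begin
        (2 * W) ^ Q    ≤⟨ ^-monoˡ-≤ Q (width-poly x (≤-trans (m≤m+n 4 _) x₀≤x)) ⟩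
        (x ^ 10) ^ Q   ≡⟨ ^-*-assoc x 10 Q ⟩
        x ^ (10 * Q)   ≤⟨ poly≤exp (10 * Q) x (≤-trans (m≤n+m _ 4) x₀≤x) ⟩
        2 ^ x          ≤⟨ lower ⟩
        n              ∎
      W≤n : W ≤ n
      W≤n = begin
        W                                   ≤⟨ m≤n*m W 2 ⟩
        -- `Q` unfolds to `suc (q + 1 * suc q)`, so one factor splits off.
        2 * W                               ≤⟨ m≤m*n (2 * W) _ {{m^n≢0 (2 * W) (q + 1 * suc q)}} ⟩
        (2 * W) ^ Q                         ≤⟨ width^Q≤n ⟩
        n                                   ∎
      t = n / W
      instance
        t≢0 : NonZero t
        t≢0 = >-nonZero (m≥n⇒m/n>0 W≤n)
        n≢0 : NonZero n
        n≢0 = >-nonZero (≤-trans (s≤s z≤n) n₀<n)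
      n≤2Wt : n ≤ 2 * W * t
      n≤2Wt = begin
        n                ≡⟨ m≡m%n+[m/n]*n n W ⟩
        -- Since `t ≥ 1`, rounding in `n / W` loses at most a factor 2.
        n % W + t * W    ≤⟨ +-mono-≤ (≤-trans (<⇒≤ (m%n<n n W)) (m≤m*n W t)) (≤-reflexive (*-comm t W)) ⟩
        W * t + W * t    ≡⟨ *-distribʳ-+ t W W ⟨
        (W + W) * t      ≡⟨ cong (λ w → (W + w) * t) (+-identityʳ W) ⟨
        2 * W * t        ∎
      bound : n ^ Q ≤ ((t * t) ^ suc q) * (n ^ suc p)
      bound = begin
        n ^ Q                        ≤⟨ ^-monoˡ-≤ Q n≤2Wt ⟩
        (2 * W * t) ^ Q              ≡⟨ ^-distribʳ-* Q (2 * W) t ⟩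
        (2 * W) ^ Q * t ^ Q
          -- The entire polylogarithmic loss `(2 * W) ^ Q` is at most `n`, hence at most
          -- `n ^ suc p`.
          ≤⟨ *-monoˡ-≤ (t ^ Q) (≤-trans width^Q≤n (m≤m*n n (n ^ p) {{m^n≢0 n p}})) ⟩
        n ^ suc p * t ^ Q            ≡⟨ *-comm (n ^ suc p) (t ^ Q) ⟩
        t ^ Q * n ^ suc p            ≡⟨ cong (_* n ^ suc p) (^-*-assoc t 2 (suc q)) ⟨
        (t ^ 2) ^ suc q * n ^ suc p  ≡⟨ cong (λ s → (t * s) ^ suc q * n ^ suc p) (*-identityʳ t) ⟩
        (t * t) ^ suc q * n ^ suc p  ∎
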